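{- Let $Ax$ be a set formed by one or more of the axiom schemas (ciw), (ci), (cl), (cf), (ce), (ca$_\wedge$), (ca$_\vee$), (ca$_\to$), and let $\Gamma\cup\{\varphi\}\subseteq For(\Sigma)$. Then $\Gamma\vdash_{\mathbf{RmbC}(Ax)}\varphi$ if and only if $\Gamma\models_{\mathbb{BI}(Ax)}\varphi$.
   Context: Let $\Sigma=\{\wedge,\vee,\to,\neg,\circ\}$ ($\neg,\circ$ unary, the others binary) and let $For(\Sigma)$ be the algebra of formulas over $\Sigma$ generated by a denumerable set $\mathcal V$ of propositional variables. $\alpha\leftrightarrow\beta$ abbreviates $(\alpha\to\beta)\wedge(\beta\to\alpha)$. $\mathbf{RmbC}$ is the Hilbert calculus with axiom schemas: (Ax1) $\alpha\to(\beta\to\alpha)$; (Ax2) $(\alpha\to(\beta\to\gamma))\to((\alpha\to\beta)\to(\alpha\to\gamma))$; (Ax3) $\alpha\to(\beta\to(\alpha\wedge\beta))$; (Ax4) $(\alpha\wedge\beta)\to\alpha$; (Ax5) $(\alpha\wedge\beta)\to\beta$; (Ax6) $\alpha\to(\alpha\vee\beta)$; (Ax7) $\beta\to(\alpha\vee\beta)$; (Ax8) $(\alpha\to\gamma)\to((\beta\to\gamma)\to((\alpha\vee\beta)\to\gamma))$; (Ax9) $(\alpha\to\beta)\vee\alpha$; (Ax10) $\alpha\vee\neg\alpha$; (bc1) $\circ\alpha\to(\alpha\to(\neg\alpha\to\beta))$; and rules: (MP) from $\alpha$ and $\alpha\to\beta$ infer $\beta$; $(\mathbf R_\neg)$ from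 $\alpha\leftrightarrow\beta$ infer $\neg\alpha\leftrightarrow\neg\beta$; $(\mathbf R_\circ)$ from $\alpha\leftrightarrow\beta$ infer $\circ\alpha\leftrightarrow\circ\beta$. Additional schemas: (ciw) $\circ\alpha\vee(\alpha\wedge\neg\alpha)$; (ci) $\neg\circ\alpha\to(\alpha\wedge\neg\alpha)$; (cl) $\neg(\alpha\wedge\neg\alpha)\to\circ\alpha$; (cf) $\neg\neg\alpha\to\alpha$; (ce) $\alpha\to\neg\neg\alpha$; (ca$_\#$) $(\circ\alpha\wedge\circ\beta)\to\circ(\alpha\#\beta)$ for $\#\in\{\wedge,\vee,\to\}$. $\mathbf{RmbC}(Ax)$ is $\mathbf{RmbC}$ plus the schemas in $Ax$. In it, $\varphi$ is a theorem ($\vdash\varphi$) if there is a finite sequence of formulas ending in $\varphi$ each of which is an instance of an axiom schema or follows from earlier formulas of the sequence by a rule; $\Gamma\vdash\varphi$ means that either $\vdash\varphi$ or there is a finite non-empty $\{\gamma_1,\dots,\gamma_n\}\subseteq\Gamma$ with $\vdash(\gamma_1\wedge(\gamma_2\wedge(\cdots\wedge(\gamma_{n-1}\wedge\gamma_n)\cdots)))\to\varphi$. A BALFI is an algebra $\mathcal B=\langle A,\wedge,\vee,\to,\neg,\circ,0,1\rangle$ such that $\langle A,\wedge,\vee,\to,0,1\rangle$ is a Boolean algebra (with $a\to b$ the Boolean implication) and $a\vee\neg a=1$, $a\wedge\neg a\wedge\circ a=0$ for all $a\in A$. A valuation over $\mathcal B$ is a $\Sigma$-homomorphism $v:For(\Sigma)\to\mathcal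 B$. $\mathcal B$ is a model of a schema if every valuation over $\mathcal B$ gives the value $1$ to it (to all its instances). $\mathbb{BI}(Ax)$ is the class of BALFIs that are models of every schema in $Ax$. $\models_{\mathbb{BI}(Ax)}\varphi$ means $v(\varphi)=1$ for every $\mathcal B\in\mathbb{BI}(Ax)$ and every valuation $v$ over it. $\Gamma\models_{\mathbb{BI}(Ax)}\varphi$ means that either $\models_{\mathbb{BI}(Ax)}\varphi$ or there is a finite non-empty $\{\gamma_1,\dots,\gamma_n\}\subseteq\Gamma$ such that $\bigwedge_{i=1}^n v(\gamma_i)\le v(\varphi)$ for every $\mathcal B\in\mathbb{BI}(Ax)$ and every valuation $v$ over it. -}

module Defs where

open import Algebra.Core using (Op₁; Op₂)
open import Algebra.Lattice.Bundles using (BooleanAlgebra)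
import Algebra.Lattice.Properties.Lattice as LatticeProperties
open import Data.List.Base using (List; []; _∷_)
open import Data.List.Membership.Propositional using (_∈_)
open import Data.List.NonEmpty.Base using (List⁺; foldr₁; map)
open import Data.List.NonEmpty.Relation.Unary.All using (All)
open import Data.Nat.Base using (ℕ)
open import Data.Product.Base using (∃; _×_)
open import Data.Sum.Base using (_⊎_)
open import Level using (Level; 0ℓ; suc) renaming (_⊔_ to _⊔ˡ_)
open import Relation.Binary.Bundles using (Poset)
open import Relation.Unary using (Pred)

infix  9 ¬_ ○_
infixr 8 _∧_
infixr 7 _∨_
infixr 6 _⇒_
infix  5 _⇔ᶠ_

-- The consistency operator ∘ is written ○.
data Formula : Set where
  var         : ℕ → Formula
  _∧_ _∨_ _⇒_ : Formula → Formula → Formula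
  ¬_ ○_       : Formula → Formula

_⇔ᶠ_ : Formula → Formula → Formula
α ⇔ᶠ β = (α ⇒ β) ∧ (β ⇒ α)

data Axiom : Pred Formula 0ℓ where
  ax1  : ∀ α β   → Axiom (α ⇒ (β ⇒ α))
  ax2  : ∀ α β γ → Axiom ((α ⇒ (β ⇒ γ)) ⇒ ((α ⇒ β) ⇒ (α ⇒ γ)))
  ax3  : ∀ α β   → Axiom (α ⇒ (β ⇒ (α ∧ β)))
  ax4  : ∀ α β   → Axiom ((α ∧ β) ⇒ α)
  ax5  : ∀ α β   → Axiom ((α ∧ β) ⇒ β)
  ax6  : ∀ α β   → Axiom (α ⇒ (α ∨ β))
  ax7  : ∀ α β   → Axiom (β ⇒ (α ∨ β))
  ax8  : ∀ α β γ → Axiom ((α ⇒ γ) ⇒ ((β ⇒ γ) ⇒ ((α ∨ β) ⇒ γ)))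
  ax9  : ∀ α β   → Axiom ((α ⇒ β) ∨ α)
  ax10 : ∀ α     → Axiom (α ∨ (¬ α))
  bc1  : ∀ α β   → Axiom ((○ α) ⇒ (α ⇒ ((¬ α) ⇒ β)))

data Schema : Set where
  ciw ci cl cf ce ca∧ ca∨ ca⇒ : Schema

data Instance : Schema → Pred Formula 0ℓ where
  ciw : ∀ α   → Instance ciw ((○ α) ∨ (α ∧ (¬ α)))
  ci  : ∀ α   → Instance ci  ((¬ (○ α)) ⇒ (α ∧ (¬ α)))
  cl  : ∀ α   → Instance cl  ((¬ (α ∧ (¬ α))) ⇒ (○ α))
  cf  : ∀ α   → Instance cf  ((¬ (¬ α)) ⇒ α)
  ce  : ∀ α   → Instance ce  (α ⇒ (¬ (¬ α)))
  ca∧ : ∀ α β → Instance ca∧ (((○ α) ∧ (○ β)) ⇒ (○ (α ∧ β)))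
  ca∨ : ∀ α β → Instance ca∨ (((○ α) ∧ (○ β)) ⇒ (○ (α ∨ β)))
  ca⇒ : ∀ α β → Instance ca⇒ (((○ α) ∧ (○ β)) ⇒ (○ (α ⇒ β)))

-- Justified Ax Π φ: φ may be appended to a derivation whose formulas so
-- far are those of Π.
data Justified (Ax : Pred Schema 0ℓ) (Π : List Formula) : Pred Formula 0ℓ where
  axiom  : ∀ {φ}     → Axiom φ → Justified Ax Π φ
  schema : ∀ {s φ}   → Ax s → Instance s φ → Justified Ax Π φ
  mp     : ∀ {α β}   → α ∈ Π → (α ⇒ β) ∈ Π → Justified Ax Π β
  R¬     : ∀ {α β}   → (α ⇔ᶠ β) ∈ Π → Justified Ax Π ((¬ α) ⇔ᶠ (¬ β))
  R○     : ∀ {α β}   → (α ⇔ᶠ β) ∈ Π → Justified Ax Π ((○ α) ⇔ᶠ (○ β))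

-- Derivations are listed in reverse: the head is the last formula.
data Derivation (Ax : Pred Schema 0ℓ) : Pred (List Formula) 0ℓ where
  []  : Derivation Ax []
  _∷_ : ∀ {φ Π} → Justified Ax Π φ → Derivation Ax Π → Derivation Ax (φ ∷ Π)

infix 4 ⊢[_]_ _⊢[_]_

⊢[_]_ : Pred Schema 0ℓ → Formula → Set
⊢[ Ax ] φ = ∃ λ Π → Derivation Ax (φ ∷ Π)

-- A finite non-empty subset {γ₁,…,γₙ} of Γ is given by an enumeration of
-- its elements, and foldr₁ _∧_ associates to the right with γₙ innermost.
_⊢[_]_ : ∀ {g} → Pred Formula g → Pred Schema 0ℓ → Formula → Set g
Γ ⊢[ Ax ] φ =
  (⊢[ Ax ] φ) ⊎ (∃ λ (γs : List⁺ Formula) → All Γ γs × (⊢[ Ax ] (foldr₁ _∧_ γs ⇒ φ)))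

-- The Boolean operations are renamed: _ᶜ is the Boolean complement, while
-- ∼ and ● interpret ¬ and ∘.  The latter two are arbitrary operations on
-- the carrier, so they must respect its equality _≈_.
record BALFI c ℓ : Set (suc (c ⊔ˡ ℓ)) where
  field
    booleanAlgebra : BooleanAlgebra c ℓ

  open BooleanAlgebra booleanAlgebra public
    using (Carrier; _≈_; ⊤; ⊥; lattice)
    renaming (_∧_ to _⊓_; _∨_ to _⊔_; ¬_ to _ᶜ)

  open Poset (LatticeProperties.poset lattice) public using (_≤_)

  _⟶_ : Op₂ Carrier
  a ⟶ b = (a ᶜ) ⊔ b

  field
    ∼_     : Op₁ Carrier
    ●_     : Op₁ Carrier
    ∼-cong : ∀ {a b} → a ≈ b → (∼ a) ≈ (∼ b)
    ●-cong : ∀ {a b} → a ≈ b → (● a) ≈ (● b)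
    ∼-⊤    : ∀ a → (a ⊔ (∼ a)) ≈ ⊤
    ●-⊥    : ∀ a → ((a ⊓ (∼ a)) ⊓ (● a)) ≈ ⊥

record Valuation {c ℓ} (B : BALFI c ℓ) : Set (c ⊔ˡ ℓ) where
  open BALFI B
  field
    ⟦_⟧    : Formula → Carrier
    ∧-homo : ∀ α β → ⟦ α ∧ β ⟧ ≈ (⟦ α ⟧ ⊓ ⟦ β ⟧)
    ∨-homo : ∀ α β → ⟦ α ∨ β ⟧ ≈ (⟦ α ⟧ ⊔ ⟦ β ⟧)
    ⇒-homo : ∀ α β → ⟦ α ⇒ β ⟧ ≈ (⟦ α ⟧ ⟶ ⟦ β ⟧)
    ¬-homo : ∀ α → ⟦ ¬ α ⟧ ≈ (∼ ⟦ α ⟧)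
    ○-homo : ∀ α → ⟦ ○ α ⟧ ≈ (● ⟦ α ⟧)

IsModel : ∀ {c ℓ} → BALFI c ℓ → Schema → Set (c ⊔ˡ ℓ)
IsModel B s = ∀ (v : Valuation B) {ψ} → Instance s ψ → Valuation.⟦ v ⟧ ψ ≈ ⊤
  where open BALFI B

𝔹𝕀 : ∀ c ℓ → Pred Schema 0ℓ → Pred (BALFI c ℓ) (c ⊔ˡ ℓ)
𝔹𝕀 c ℓ Ax B = ∀ {s} → Ax s → IsModel B s

infix 4 ⊨[_,_,_]_ _⊨[_,_,_]_

-- The levels c and ℓ bound the size of the BALFIs that are quantified over.
⊨[_,_,_]_ : ∀ c ℓ → Pred Schema 0ℓ → Formula → Set (suc (c ⊔ˡ ℓ))
⊨[ c , ℓ , Ax ] φ =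
  ∀ (B : BALFI c ℓ) → 𝔹𝕀 c ℓ Ax B → (v : Valuation B) →
  let open BALFI B; open Valuation v in ⟦ φ ⟧ ≈ ⊤

_⊨[_,_,_]_ : ∀ {g} → Pred Formula g → ∀ c ℓ → Pred Schema 0ℓ → Formula →
             Set (g ⊔ˡ suc (c ⊔ˡ ℓ))
Γ ⊨[ c , ℓ , Ax ] φ =
  (⊨[ c , ℓ , Ax ] φ) ⊎
  (∃ λ (γs : List⁺ Formula) → All Γ γs ×
    (∀ (B : BALFI c ℓ) → 𝔹𝕀 c ℓ Ax B → (v : Valuation B) →
     let open BALFI B; open Valuation v in foldr₁ _⊓_ (map ⟦_⟧ γs) ≤ ⟦ φ ⟧))

{-# OPTIONS --safe #-}

-- Soundness: under a valuation, α ⇒ β is valid iff the value of α is below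
-- that of β, so the propositional axioms are the laws of a Heyting algebra.
-- Completeness: provable equivalence is a congruence thanks to R¬ and R○, and
-- the resulting Lindenbaum–Tarski algebra is a BALFI.  A valuation over it is
-- a substitution, so it is a model of every schema in Ax; a formula valid
-- under its canonical valuation is a theorem.
module Submission where

open import Algebra.Lattice.Bundles using (BooleanAlgebra)
import Algebra.Lattice.Properties.BooleanAlgebra as BooleanAlgebraProperties
open import Algebra.Lattice.Structures.Biased using (isBooleanAlgebraʳ)
open import Data.List.Base using ([]; _∷_; _++_)
open import Data.List.Membership.Propositional using (_∈_)
open import Data.List.Membership.Propositional.Properties using (∈-++⁺ˡ; ∈-++⁺ʳ)
open import Data.List.NonEmpty.Base using (foldr₁; map; _∷_)
open import Data.List.Relation.Unary.Any using (here; there)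
open import Data.Nat.Base using (ℕ)
open import Data.Product.Base using (_,_)
open import Data.Sum.Base using (inj₁; inj₂)
open import Defs
open import Function.Base using (_∘_; _on_)
open import Function.Bundles using (_⇔_; mk⇔)
open import Level using (Level; 0ℓ; Lift; lift; lower)
open import Relation.Binary.Construct.Interior.Symmetric using (isPartialOrder; _,_)
open import Relation.Binary.Core using (Rel)
open import Relation.Binary.Lattice using (HeytingAlgebra; Lattice)
import Relation.Binary.Lattice.Properties.DistributiveLattice as DistributiveLatticeProperties
import Relation.Binary.Lattice.Properties.HeytingAlgebra as HeytingAlgebraProperties
import Relation.Binary.Lattice.Properties.Lattice as LatticeProperties
open import Relation.Binary.PropositionalEquality using (refl)
import Relation.Binary.Reasoning.PartialOrder as PosetReasoning
import Relation.Binary.Reasoning.Setoid as SetoidReasoning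
open import Relation.Unary using (Pred; Satisfiable)

private
  variable
    g c ℓ ℓ₁ ℓ₂ : Level

-- Boolean algebras as Heyting algebras.

module _ (A : BooleanAlgebra c ℓ) where
  open BooleanAlgebra A
    using (⊤; ⊥; sym; ∨-congʳ; ∧-comm; ∧-congˡ; ∧-distribʳ-∨; ∧-complementˡ; ∨-complementʳ)
    renaming (_∧_ to _⊓_; _∨_ to _⊔_; ¬_ to _ᶜ)
  open BooleanAlgebraProperties A
    using (∨-∧-orderTheoreticLattice; ∧-identityʳ; ∧-zeroˡ; ∨-identityˡ)
  private
    module L = Lattice ∨-∧-orderTheoreticLattice
  open L using (_≤_)

  private
    ⟶-intro : ∀ {x y z} → (x ⊓ y) ≤ z → x ≤ ((y ᶜ) ⊔ z)
    ⟶-intro {x} {y} {z} x⊓y≤z = begin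
      x                        ≈⟨ ∧-identityʳ x ⟨
      x ⊓ ⊤                    ≈⟨ ∧-congˡ (∨-complementʳ y) ⟨
      x ⊓ (y ⊔ (y ᶜ))          ≈⟨ ∧-comm _ _ ⟩
      (y ⊔ (y ᶜ)) ⊓ x          ≈⟨ ∧-distribʳ-∨ x y (y ᶜ) ⟩
      (y ⊓ x) ⊔ ((y ᶜ) ⊓ x)    ≤⟨ L.∨-least
        (L.trans (L.reflexive (∧-comm y x)) (L.trans x⊓y≤z (L.y≤x∨y _ _)))
        (L.trans (L.x∧y≤x _ _) (L.x≤x∨y _ _)) ⟩
      (y ᶜ) ⊔ z                ∎
      where open PosetReasoning L.poset

    ⟶-elim : ∀ {x y z} → x ≤ ((y ᶜ) ⊔ z) → (x ⊓ y) ≤ z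
    ⟶-elim {x} {y} {z} x≤y⟶z = begin
      x ⊓ y                    ≤⟨ L.∧-greatest (L.trans (L.x∧y≤x _ _) x≤y⟶z) (L.x∧y≤y _ _) ⟩
      ((y ᶜ) ⊔ z) ⊓ y          ≈⟨ ∧-distribʳ-∨ y (y ᶜ) z ⟩
      ((y ᶜ) ⊓ y) ⊔ (z ⊓ y)    ≈⟨ ∨-congʳ (∧-complementˡ y) ⟩
      ⊥ ⊔ (z ⊓ y)              ≈⟨ ∨-identityˡ _ ⟩
      z ⊓ y                    ≤⟨ L.x∧y≤x _ _ ⟩
      z                        ∎
      where open PosetReasoning L.poset

  -- The order is the one a BALFI carries: `x ≤ y` unfolds to `x ≈ x ⊓ y`, so the bounds are the
  -- identity and zero laws of meet.
  booleanAlgebra⇒heytingAlgebra : HeytingAlgebra c ℓ ℓ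
  booleanAlgebra⇒heytingAlgebra = record
    { _⇨_ = λ x y → (x ᶜ) ⊔ y
    ; ⊤ = ⊤
    ; ⊥ = ⊥
    ; isHeytingAlgebra = record
      { isBoundedLattice = record
        { isLattice = L.isLattice
        ; maximum   = λ x → sym (∧-identityʳ x)
        ; minimum   = λ x → sym (∧-zeroˡ x)
        }
      ; exponential = λ _ _ _ → ⟶-intro , ⟶-elim
      }
    }

-- Heyting algebras with excluded middle as Boolean algebras.

module _ (H : HeytingAlgebra c ℓ₁ ℓ₂) where
  open HeytingAlgebra H
    using ( _≈_; _⇨_; ⊤; ⊥; poset; lattice; module Eq; antisym; trans; reflexive; maximum; minimum
          ; x≤x∨y; y≤x∨y; ∨-least; ∧-greatest; x∧y≤y)
    renaming (refl to ≤-refl; _∧_ to _⊓_; _∨_ to _⊔_)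
  open HeytingAlgebraProperties H using
    (distributiveLattice; ⇨-cong; ⇨-eval; ⇨-applyʳ; ∧-distribˡ-∨; ⇨ʳ-covariant; y≤x⇨y)
  open DistributiveLatticeProperties distributiveLattice using (∧-distrib-∨; ∨-distrib-∧)

  module _ (excludedMiddle : ∀ x → (x ⊔ (x ⇨ ⊥)) ≈ ⊤) where

    heytingAlgebra⇒booleanAlgebra : BooleanAlgebra c ℓ₁
    heytingAlgebra⇒booleanAlgebra = record
      { isBooleanAlgebra = isBooleanAlgebraʳ {_≈_ = _≈_} record
        { isDistributiveLattice = record
          { isLattice   = LatticeProperties.isAlgLattice lattice
          ; ∨-distrib-∧ = ∨-distrib-∧
          ; ∧-distrib-∨ = ∧-distrib-∨
          }
        ; ∨-complementʳ = excludedMiddle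
        ; ∧-complementʳ = λ x → antisym (⇨-applyʳ ≤-refl) (minimum _)
        ; ¬-cong        = λ x≈y → ⇨-cong x≈y Eq.refl
        }
      }

    -- A BALFI defines its implication from complement and join. This law identifies that operation
    -- with the residual, as `⇒-homo` requires in the Lindenbaum-Tarski algebra. The nontrivial half
    -- splits `x ⇨ y` along `x ⊔ (x ⇨ ⊥)`.
    ⇨-classical : ∀ x y → (x ⇨ y) ≈ ((x ⇨ ⊥) ⊔ y)
    ⇨-classical x y = antisym
      (begin
        x ⇨ y                                  ≤⟨ ∧-greatest ≤-refl
          (trans (maximum _) (reflexive (Eq.sym (excludedMiddle x)))) ⟩
        (x ⇨ y) ⊓ (x ⊔ (x ⇨ ⊥))                ≈⟨ ∧-distribˡ-∨ _ _ _ ⟩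
        ((x ⇨ y) ⊓ x) ⊔ ((x ⇨ y) ⊓ (x ⇨ ⊥))    ≤⟨ ∨-least
          (trans ⇨-eval (y≤x∨y _ _)) (trans (x∧y≤y _ _) (x≤x∨y _ _)) ⟩
        (x ⇨ ⊥) ⊔ y                            ∎)
      (∨-least (⇨ʳ-covariant (minimum y)) y≤x⇨y)
      where open PosetReasoning poset

-- Valuations over a BALFI.

module _ {B : BALFI c ℓ} where
  open BALFI B
  open BooleanAlgebra booleanAlgebra using (setoid; ∧-cong; ∧-congˡ; ∨-cong; ¬-cong)
    renaming (refl to ≈-refl; trans to ≈-trans)
  open SetoidReasoning setoid

  ⟶-cong : ∀ {a a′ b b′} → a ≈ a′ → b ≈ b′ → (a ⟶ b) ≈ (a′ ⟶ b′)
  ⟶-cong a≈a′ b≈b′ = ∨-cong (¬-cong a≈a′) b≈b′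

  open Valuation using (⟦_⟧)

  -- Freeness of the formula algebra, by induction on the formula. It serves to recognise an
  -- arbitrary valuation over the Lindenbaum-Tarski algebra as a substitution.
  valuation-unique : (u v : Valuation B) → (∀ n → ⟦ u ⟧ (var n) ≈ ⟦ v ⟧ (var n)) →
                     ∀ α → ⟦ u ⟧ α ≈ ⟦ v ⟧ α
  valuation-unique u v vars = go
    where
    module U = Valuation u
    module V = Valuation v
    go : ∀ α → U.⟦ α ⟧ ≈ V.⟦ α ⟧
    go (var n) = vars n
    go (α ∧ β) = begin
      U.⟦ α ∧ β ⟧         ≈⟨ U.∧-homo α β ⟩
      U.⟦ α ⟧ ⊓ U.⟦ β ⟧   ≈⟨ ∧-cong (go α) (go β) ⟩
      V.⟦ α ⟧ ⊓ V.⟦ β ⟧   ≈⟨ V.∧-homo α β ⟨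
      V.⟦ α ∧ β ⟧         ∎
    go (α ∨ β) = begin
      U.⟦ α ∨ β ⟧         ≈⟨ U.∨-homo α β ⟩
      U.⟦ α ⟧ ⊔ U.⟦ β ⟧   ≈⟨ ∨-cong (go α) (go β) ⟩
      V.⟦ α ⟧ ⊔ V.⟦ β ⟧   ≈⟨ V.∨-homo α β ⟨
      V.⟦ α ∨ β ⟧         ∎
    go (α ⇒ β) = begin
      U.⟦ α ⇒ β ⟧         ≈⟨ U.⇒-homo α β ⟩
      U.⟦ α ⟧ ⟶ U.⟦ β ⟧   ≈⟨ ⟶-cong (go α) (go β) ⟩
      V.⟦ α ⟧ ⟶ V.⟦ β ⟧   ≈⟨ V.⇒-homo α β ⟨
      V.⟦ α ⇒ β ⟧         ∎
    go (¬ α) = begin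
      U.⟦ ¬ α ⟧   ≈⟨ U.¬-homo α ⟩
      ∼ U.⟦ α ⟧   ≈⟨ ∼-cong (go α) ⟩
      ∼ V.⟦ α ⟧   ≈⟨ V.¬-homo α ⟨
      V.⟦ ¬ α ⟧   ∎
    go (○ α) = begin
      U.⟦ ○ α ⟧   ≈⟨ U.○-homo α ⟩
      ● U.⟦ α ⟧   ≈⟨ ●-cong (go α) ⟩
      ● V.⟦ α ⟧   ≈⟨ V.○-homo α ⟨
      V.⟦ ○ α ⟧   ∎

  foldr₁-homo : (v : Valuation B) → ∀ γs →
                 ⟦ v ⟧ (foldr₁ _∧_ γs) ≈ foldr₁ _⊓_ (map ⟦ v ⟧ γs)
  foldr₁-homo v (γ ∷ γs) = go γ γs
    where
    -- Separating head from tail makes the recursion structural in the tail.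
    go : ∀ γ γs → ⟦ v ⟧ (foldr₁ _∧_ (γ ∷ γs)) ≈ foldr₁ _⊓_ (map ⟦ v ⟧ (γ ∷ γs))
    go γ []       = ≈-refl
    go γ (δ ∷ γs) = ≈-trans (Valuation.∧-homo v γ _) (∧-congˡ (go δ γs))

-- Soundness.

module Soundness {B : BALFI c ℓ} (v : Valuation B) where
  open BALFI B
  open Valuation v
  private
    module H = HeytingAlgebra (booleanAlgebra⇒heytingAlgebra booleanAlgebra)
  open BooleanAlgebra booleanAlgebra
    using (∨-assoc; ∨-comm; ∨-congˡ; ∨-congʳ; ∨-complementˡ; ∧-congʳ; ∧-cong)
  open BooleanAlgebraProperties booleanAlgebra using (∨-zeroʳ)

  infix 4 _⊑_

  -- Comparing formulas by their values lets the Heyting rules be restated for connectives, so the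
  -- homomorphism laws are applied once per rule instead of in every axiom.
  _⊑_ : Rel Formula ℓ
  _⊑_ = _≤_ on ⟦_⟧

  ⊤≤⇒≈⊤ : ∀ {x} → ⊤ ≤ x → x ≈ ⊤
  ⊤≤⇒≈⊤ = H.antisym (H.maximum _)

  ∧-elimˡ : ∀ {α β} → α ∧ β ⊑ α
  ∧-elimˡ = H.trans (H.reflexive (∧-homo _ _)) (H.x∧y≤x _ _)

  ∧-elimʳ : ∀ {α β} → α ∧ β ⊑ β
  ∧-elimʳ = H.trans (H.reflexive (∧-homo _ _)) (H.x∧y≤y _ _)

  ∧-intro : ∀ {α β γ} → γ ⊑ α → γ ⊑ β → γ ⊑ α ∧ β
  ∧-intro p q = H.trans (H.∧-greatest p q) (H.reflexive (H.Eq.sym (∧-homo _ _)))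

  ∨-introˡ : ∀ {α β} → α ⊑ α ∨ β
  ∨-introˡ = H.trans (H.x≤x∨y _ _) (H.reflexive (H.Eq.sym (∨-homo _ _)))

  ∨-introʳ : ∀ {α β} → β ⊑ α ∨ β
  ∨-introʳ = H.trans (H.y≤x∨y _ _) (H.reflexive (H.Eq.sym (∨-homo _ _)))

  ∨-elim : ∀ {α β γ} → α ⊑ γ → β ⊑ γ → α ∨ β ⊑ γ
  ∨-elim p q = H.trans (H.reflexive (∨-homo _ _)) (H.∨-least p q)

  ⇒-intro : ∀ {α β γ} → α ∧ β ⊑ γ → α ⊑ β ⇒ γ
  ⇒-intro p = H.trans (H.transpose-⇨ (H.trans (H.reflexive (H.Eq.sym (∧-homo _ _))) p))
                      (H.reflexive (H.Eq.sym (⇒-homo _ _)))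

  ⇒-elim : ∀ {α β γ} → γ ⊑ α ⇒ β → γ ⊑ α → γ ⊑ β
  ⇒-elim p q = H.trans (H.∧-greatest H.refl q)
                       (H.transpose-∧ (H.trans p (H.reflexive (⇒-homo _ _))))

  ⇒-valid⁺ : ∀ {α β} → α ⊑ β → ⟦ α ⇒ β ⟧ ≈ ⊤
  ⇒-valid⁺ p = ⊤≤⇒≈⊤ (H.trans (H.transpose-⇨ (H.trans (H.x∧y≤y _ _) p))
                              (H.reflexive (H.Eq.sym (⇒-homo _ _))))

  ⇒-valid⁻ : ∀ {α β} → ⟦ α ⇒ β ⟧ ≈ ⊤ → α ⊑ β
  ⇒-valid⁻ p = ⇒-elim (H.trans (H.maximum _) (H.reflexive (H.Eq.sym p))) H.refl

  ⇔-valid⁺ : ∀ {α β} → ⟦ α ⟧ ≈ ⟦ β ⟧ → ⟦ α ⇔ᶠ β ⟧ ≈ ⊤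
  ⇔-valid⁺ p = ⊤≤⇒≈⊤ (H.trans
    (H.∧-greatest (H.reflexive (H.Eq.sym (⇒-valid⁺ (H.reflexive p))))
                  (H.reflexive (H.Eq.sym (⇒-valid⁺ (H.reflexive (H.Eq.sym p))))))
    (H.reflexive (H.Eq.sym (∧-homo _ _))))

  -- Turns the premise of `R¬` or `R○` into an equality of values, to which `∼-cong` or `●-cong`
  -- applies.
  ⇔-valid⁻ : ∀ {α β} → ⟦ α ⇔ᶠ β ⟧ ≈ ⊤ → ⟦ α ⟧ ≈ ⟦ β ⟧
  ⇔-valid⁻ p = H.antisym (⇒-valid⁻ (⊤≤⇒≈⊤ (H.trans ⊤≤ ∧-elimˡ)))
                         (⇒-valid⁻ (⊤≤⇒≈⊤ (H.trans ⊤≤ ∧-elimʳ)))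
    where ⊤≤ = H.reflexive (H.Eq.sym p)

  contradiction⊑ : ∀ {α β} → (α ∧ ¬ α) ∧ ○ α ⊑ β
  contradiction⊑ {α} {β} = begin
    ⟦ (α ∧ ¬ α) ∧ ○ α ⟧               ≈⟨ ∧-homo _ _ ⟩
    ⟦ α ∧ ¬ α ⟧ ⊓ ⟦ ○ α ⟧             ≈⟨ ∧-cong (∧-homo _ _) (○-homo α) ⟩
    (⟦ α ⟧ ⊓ ⟦ ¬ α ⟧) ⊓ (● ⟦ α ⟧)     ≈⟨ ∧-congʳ (∧-cong H.Eq.refl (¬-homo α)) ⟩
    (⟦ α ⟧ ⊓ (∼ ⟦ α ⟧)) ⊓ (● ⟦ α ⟧)   ≈⟨ ●-⊥ ⟦ α ⟧ ⟩
    ⊥                                 ≤⟨ H.minimum _ ⟩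
    ⟦ β ⟧                             ∎
    where open PosetReasoning H.poset

  axiom-valid : ∀ {φ} → Axiom φ → ⟦ φ ⟧ ≈ ⊤
  axiom-valid (ax1 α β)   = ⇒-valid⁺ (⇒-intro ∧-elimˡ)
  axiom-valid (ax2 α β γ) = ⇒-valid⁺ (⇒-intro (⇒-intro (⇒-elim
    (⇒-elim (H.trans ∧-elimˡ ∧-elimˡ) ∧-elimʳ)
    (⇒-elim (H.trans ∧-elimˡ ∧-elimʳ) ∧-elimʳ))))
  axiom-valid (ax3 α β)   = ⇒-valid⁺ (⇒-intro H.refl)
  axiom-valid (ax4 α β)   = ⇒-valid⁺ ∧-elimˡ
  axiom-valid (ax5 α β)   = ⇒-valid⁺ ∧-elimʳ
  axiom-valid (ax6 α β)   = ⇒-valid⁺ ∨-introˡ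
  axiom-valid (ax7 α β)   = ⇒-valid⁺ ∨-introʳ
  -- The disjunction is eliminated into `(α ⇒ γ) ∧ (β ⇒ γ) ⇒ γ`, so that both implications remain
  -- available in each case.
  axiom-valid (ax8 α β γ) = ⇒-valid⁺ (⇒-intro (⇒-intro (⇒-elim
    (H.trans ∧-elimʳ (∨-elim
      (⇒-intro (⇒-elim (H.trans ∧-elimʳ ∧-elimˡ) ∧-elimˡ))
      (⇒-intro (⇒-elim (H.trans ∧-elimʳ ∧-elimʳ) ∧-elimˡ))))
    ∧-elimˡ)))
  -- This law fails in some Heyting algebras, so the implication is unfolded to complement and join.
  axiom-valid (ax9 α β)   = begin
    ⟦ (α ⇒ β) ∨ α ⟧                 ≈⟨ ∨-homo _ _ ⟩
    ⟦ α ⇒ β ⟧ ⊔ ⟦ α ⟧               ≈⟨ ∨-congʳ (⇒-homo α β) ⟩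
    ((⟦ α ⟧ ᶜ) ⊔ ⟦ β ⟧) ⊔ ⟦ α ⟧     ≈⟨ ∨-congʳ (∨-comm _ _) ⟩
    (⟦ β ⟧ ⊔ (⟦ α ⟧ ᶜ)) ⊔ ⟦ α ⟧     ≈⟨ ∨-assoc _ _ _ ⟩
    ⟦ β ⟧ ⊔ ((⟦ α ⟧ ᶜ) ⊔ ⟦ α ⟧)     ≈⟨ ∨-congˡ (∨-complementˡ _) ⟩
    ⟦ β ⟧ ⊔ ⊤                       ≈⟨ ∨-zeroʳ _ ⟩
    ⊤                               ∎
    where open SetoidReasoning H.setoid
  axiom-valid (ax10 α)    = begin
    ⟦ α ∨ ¬ α ⟧           ≈⟨ ∨-homo _ _ ⟩
    ⟦ α ⟧ ⊔ ⟦ ¬ α ⟧       ≈⟨ ∨-congˡ (¬-homo α) ⟩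
    ⟦ α ⟧ ⊔ (∼ ⟦ α ⟧)     ≈⟨ ∼-⊤ _ ⟩
    ⊤                     ∎
    where open SetoidReasoning H.setoid
  axiom-valid (bc1 α β)   = ⇒-valid⁺ (⇒-intro (⇒-intro (H.trans
    (∧-intro (∧-intro (H.trans ∧-elimˡ ∧-elimʳ) ∧-elimʳ) (H.trans ∧-elimˡ ∧-elimˡ))
    contradiction⊑)))

  module _ {Ax : Pred Schema 0ℓ} (model : 𝔹𝕀 c ℓ Ax B) where

    -- The premises must have value `⊤`: since `∼` and `●` need only respect equality, `R¬` and `R○`
    -- preserve validity but in general not the order.
    justified-valid : ∀ {Π} → (∀ {α} → α ∈ Π → ⟦ α ⟧ ≈ ⊤) →
                      ∀ {φ} → Justified Ax Π φ → ⟦ φ ⟧ ≈ ⊤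
    justified-valid Π≈⊤ (axiom a)       = axiom-valid a
    justified-valid Π≈⊤ (schema s i)    = model s v i
    justified-valid Π≈⊤ (mp α∈ α⇒β∈)    =
      ⊤≤⇒≈⊤ (H.trans (H.reflexive (H.Eq.sym (Π≈⊤ α∈))) (⇒-valid⁻ (Π≈⊤ α⇒β∈)))
    justified-valid Π≈⊤ (R¬ {α} {β} α⇔β∈) = ⇔-valid⁺
      (H.Eq.trans (¬-homo α) (H.Eq.trans (∼-cong (⇔-valid⁻ (Π≈⊤ α⇔β∈))) (H.Eq.sym (¬-homo β))))
    justified-valid Π≈⊤ (R○ {α} {β} α⇔β∈) = ⇔-valid⁺
      (H.Eq.trans (○-homo α) (H.Eq.trans (●-cong (⇔-valid⁻ (Π≈⊤ α⇔β∈))) (H.Eq.sym (○-homo β))))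

    derivation-valid : ∀ {Π} → Derivation Ax Π → ∀ {α} → α ∈ Π → ⟦ α ⟧ ≈ ⊤
    derivation-valid (j ∷ d) (here refl) = justified-valid (derivation-valid d) j
    derivation-valid (j ∷ d) (there α∈)  = derivation-valid d α∈

    theorem-valid : ∀ {φ} → ⊢[ Ax ] φ → ⟦ φ ⟧ ≈ ⊤
    theorem-valid (_ , d) = derivation-valid d (here refl)

soundness : ∀ {Ax : Pred Schema 0ℓ} (Γ : Pred Formula g) φ → Γ ⊢[ Ax ] φ → Γ ⊨[ c , ℓ , Ax ] φ
soundness Γ φ (inj₁ ⊢φ)             = inj₁ λ B model v → Soundness.theorem-valid v model ⊢φ
soundness Γ φ (inj₂ (γs , γs⊆Γ , ⊢)) = inj₂ (γs , γs⊆Γ , λ B model v →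
  let open BooleanAlgebra (BALFI.booleanAlgebra B) using (sym; trans; ∧-congʳ)
      ⋀≈ = foldr₁-homo v γs
  -- The order is an equation `x ≈ x ⊓ y`, whence the chain of equalities replacing both occurrences
  -- of the conjunction.
  in trans (sym ⋀≈) (trans (Soundness.⇒-valid⁻ v (Soundness.theorem-valid v model ⊢)) (∧-congʳ ⋀≈)))

-- Substitution.

infixl 10 _[_]

_[_] : Formula → (ℕ → Formula) → Formula
var n   [ σ ] = σ n
(α ∧ β) [ σ ] = α [ σ ] ∧ β [ σ ]
(α ∨ β) [ σ ] = α [ σ ] ∨ β [ σ ]
(α ⇒ β) [ σ ] = α [ σ ] ⇒ β [ σ ]
(¬ α)   [ σ ] = ¬ (α [ σ ])
(○ α)   [ σ ] = ○ (α [ σ ])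

-- Schemas range over all formulas, so substituting only changes the parameters.
instance-[] : ∀ {s ψ} σ → Instance s ψ → Instance s (ψ [ σ ])
instance-[] σ (ciw α)   = ciw _
instance-[] σ (ci α)    = ci _
instance-[] σ (cl α)    = cl _
instance-[] σ (cf α)    = cf _
instance-[] σ (ce α)    = ce _
instance-[] σ (ca∧ α β) = ca∧ _ _
instance-[] σ (ca∨ α β) = ca∨ _ _
instance-[] σ (ca⇒ α β) = ca⇒ _ _

-- Derived rules of the calculus.

module Provability (Ax : Pred Schema 0ℓ) where

  infix 4 ⊢_

  ⊢_ : Formula → Set
  ⊢ φ = ⊢[ Ax ] φ

  -- Lists are reversed, so `Π′` is carried out before `Π`.
  justified-++ : ∀ {Π φ} Π′ → Justified Ax Π φ → Justified Ax (Π ++ Π′) φ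
  justified-++ Π′ (axiom a)      = axiom a
  justified-++ Π′ (schema s i)   = schema s i
  justified-++ Π′ (mp α∈ α⇒β∈)   = mp (∈-++⁺ˡ α∈) (∈-++⁺ˡ α⇒β∈)
  justified-++ Π′ (R¬ α⇔β∈)      = R¬ (∈-++⁺ˡ α⇔β∈)
  justified-++ Π′ (R○ α⇔β∈)      = R○ (∈-++⁺ˡ α⇔β∈)

  derivation-++ : ∀ {Π Π′} → Derivation Ax Π → Derivation Ax Π′ → Derivation Ax (Π ++ Π′)
  derivation-++ []      d′ = d′
  derivation-++ (j ∷ d) d′ = justified-++ _ j ∷ derivation-++ d d′

  ⊢-axiom : ∀ {φ} → Axiom φ → ⊢ φ
  ⊢-axiom a = [] , axiom a ∷ []

  ⊢-mp : ∀ {α β} → ⊢ α ⇒ β → ⊢ α → ⊢ β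
  ⊢-mp {α} (_ , d) (Π , d′) =
    -- The derivation of `α` follows that of `α ⇒ β`: `α` is the head, and the implication comes
    -- just after the block `α ∷ Π`.
    _ , mp (here refl) (∈-++⁺ʳ (α ∷ Π) (here refl)) ∷ derivation-++ d′ d

  ⊢-¬-cong : ∀ {α β} → ⊢ α ⇔ᶠ β → ⊢ ¬ α ⇔ᶠ ¬ β
  ⊢-¬-cong (_ , d) = _ , R¬ (here refl) ∷ d

  ⊢-○-cong : ∀ {α β} → ⊢ α ⇔ᶠ β → ⊢ ○ α ⇔ᶠ ○ β
  ⊢-○-cong (_ , d) = _ , R○ (here refl) ∷ d

  infix 4 _⊑_

  _⊑_ : Rel Formula 0ℓ
  α ⊑ β = ⊢ α ⇒ β

  ⊑-const : ∀ {α β} → ⊢ β → α ⊑ β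
  ⊑-const = ⊢-mp (⊢-axiom (ax1 _ _))

  -- Modus ponens under a hypothesis: `ax2` is the combinator S, and `⊑-refl` below is S K K.
  ⇒-elim : ∀ {α β γ} → γ ⊑ α ⇒ β → γ ⊑ α → γ ⊑ β
  ⇒-elim p q = ⊢-mp (⊢-mp (⊢-axiom (ax2 _ _ _)) p) q

  ⊑-refl : ∀ {α} → α ⊑ α
  ⊑-refl {α} = ⇒-elim (⊢-axiom (ax1 α (α ⇒ α))) (⊢-axiom (ax1 α α))

  ⊑-trans : ∀ {α β γ} → α ⊑ β → β ⊑ γ → α ⊑ γ
  ⊑-trans p q = ⇒-elim (⊑-const q) p

  ∧-elimˡ : ∀ {α β} → α ∧ β ⊑ α
  ∧-elimˡ = ⊢-axiom (ax4 _ _)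

  ∧-elimʳ : ∀ {α β} → α ∧ β ⊑ β
  ∧-elimʳ = ⊢-axiom (ax5 _ _)

  ∧-intro : ∀ {α β γ} → γ ⊑ α → γ ⊑ β → γ ⊑ α ∧ β
  ∧-intro p q = ⇒-elim (⊑-trans p (⊢-axiom (ax3 _ _))) q

  ∨-elim : ∀ {α β γ} → α ⊑ γ → β ⊑ γ → α ∨ β ⊑ γ
  ∨-elim p q = ⊢-mp (⊢-mp (⊢-axiom (ax8 _ _ _)) p) q

  -- Currying takes the place of a deduction theorem: `ax3` forms the pair under `β`, and `ax2`
  -- composes with the given implication.
  ⇒-intro : ∀ {α β γ} → α ∧ β ⊑ γ → α ⊑ β ⇒ γ
  ⇒-intro p = ⊑-trans (⊢-axiom (ax3 _ _)) (⊢-mp (⊢-axiom (ax2 _ _ _)) (⊑-const p))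

  ⇔-intro : ∀ {α β} → α ⊑ β → β ⊑ α → ⊢ α ⇔ᶠ β
  ⇔-intro p q = ⊢-mp (⊢-mp (⊢-axiom (ax3 _ _)) p) q

  -- The language has no constants. Variable 0 is an arbitrary choice, and `⊥ᶠ` lies below every
  -- formula by `bc1`.
  ⊤ᶠ ⊥ᶠ : Formula
  ⊤ᶠ = var 0 ⇒ var 0
  ⊥ᶠ = (var 0 ∧ ¬ var 0) ∧ ○ var 0

  ⊑⊤ : ∀ {α} → α ⊑ ⊤ᶠ
  ⊑⊤ = ⊑-const ⊑-refl

  contradiction⊑ : ∀ {α β} → (α ∧ ¬ α) ∧ ○ α ⊑ β
  contradiction⊑ = ⇒-elim
    (⇒-elim (⊑-trans ∧-elimʳ (⊢-axiom (bc1 _ _))) (⊑-trans ∧-elimˡ ∧-elimˡ))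
    (⊑-trans ∧-elimˡ ∧-elimʳ)

-- The Lindenbaum-Tarski algebra and completeness.

module LindenbaumTarski (c ℓ : Level) (Ax : Pred Schema 0ℓ) where
  open Provability Ax

  -- Lifting places the countable algebra at the levels over which semantic consequence quantifies.
  -- No quotient is formed: equality of the algebra is `≼` in both directions.
  _≼_ : Rel (Lift c Formula) ℓ
  x ≼ y = Lift ℓ (lower x ⊑ lower y)

  heytingAlgebra : HeytingAlgebra c ℓ ℓ
  heytingAlgebra = record
    { _≤_ = _≼_
    ; _∨_ = λ x y → lift (lower x ∨ lower y)
    ; _∧_ = λ x y → lift (lower x ∧ lower y)
    ; _⇨_ = λ x y → lift (lower x ⇒ lower y)
    ; ⊤   = lift ⊤ᶠ
    ; ⊥   = lift ⊥ᶠ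
    ; isHeytingAlgebra = record
      { isBoundedLattice = record
        { isLattice = record
          { isPartialOrder = isPartialOrder (lift ⊑-refl)
              (λ p q → lift (⊑-trans (lower p) (lower q)))
          ; supremum = λ x y → lift (⊢-axiom (ax6 _ _)) , lift (⊢-axiom (ax7 _ _)) ,
              λ z p q → lift (∨-elim (lower p) (lower q))
          ; infimum  = λ x y → lift ∧-elimˡ , lift ∧-elimʳ ,
              λ z p q → lift (∧-intro (lower p) (lower q))
          }
        ; maximum = λ x → lift ⊑⊤
        ; minimum = λ x → lift contradiction⊑
        }
      ; exponential = λ w x y →
          (λ p → lift (⇒-intro (lower p))) ,
          (λ p → lift (⇒-elim (⊑-trans ∧-elimˡ (lower p)) ∧-elimʳ))
      }
    }

  open HeytingAlgebra heytingAlgebra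
    using (_≈_; _⇨_; ⊤; ⊥; antisym; reflexive; maximum; minimum; module Eq)
    renaming (_∨_ to _⊔_; trans to ≼-trans; x∧y≤y to x⊓y≼y)

  ⊢⇒≈⊤ : ∀ {x} → ⊢ lower x → x ≈ ⊤
  ⊢⇒≈⊤ ⊢x = antisym (maximum _) (lift (⊑-const ⊢x))

  ≈⊤⇒⊢ : ∀ {x} → x ≈ ⊤ → ⊢ lower x
  ≈⊤⇒⊢ (_ , ⊤≼x) = ⊢-mp (lower ⊤≼x) ⊑-refl

  ≈⇒⇔ : ∀ {x y} → x ≈ y → ⊢ lower x ⇔ᶠ lower y
  ≈⇒⇔ (p , q) = ⇔-intro (lower p) (lower q)

  ⇔⇒≈ : ∀ {x y} → ⊢ lower x ⇔ᶠ lower y → x ≈ y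
  ⇔⇒≈ p = lift (⊢-mp ∧-elimˡ p) , lift (⊢-mp ∧-elimʳ p)

  excludedMiddle : ∀ x → (x ⊔ (x ⇨ ⊥)) ≈ ⊤
  -- `ax9` with `⊥ᶠ` as consequent is excluded middle with its disjuncts swapped.
  excludedMiddle x = ⊢⇒≈⊤ (⊢-mp
    (∨-elim (⊢-axiom (ax7 _ _)) (⊢-axiom (ax6 _ _)))
    (⊢-axiom (ax9 (lower x) ⊥ᶠ)))

  balfi : BALFI c ℓ
  balfi = record
    { booleanAlgebra = heytingAlgebra⇒booleanAlgebra heytingAlgebra excludedMiddle
    ; ∼_     = λ x → lift (¬ lower x)
    ; ●_     = λ x → lift (○ lower x)
    ; ∼-cong = λ x≈y → ⇔⇒≈ (⊢-¬-cong (≈⇒⇔ x≈y))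
    ; ●-cong = λ x≈y → ⇔⇒≈ (⊢-○-cong (≈⇒⇔ x≈y))
    ; ∼-⊤    = λ x → ⊢⇒≈⊤ (⊢-axiom (ax10 _))
    ; ●-⊥    = λ x → antisym (lift contradiction⊑) (minimum _)
    }

  substitution : (ℕ → Formula) → Valuation balfi
  substitution σ = record
    { ⟦_⟧    = λ α → lift (α [ σ ])
    ; ∧-homo = λ α β → Eq.refl
    ; ∨-homo = λ α β → Eq.refl
    ; ⇒-homo = λ α β → ⇨-classical heytingAlgebra excludedMiddle _ _
    ; ¬-homo = λ α → Eq.refl
    ; ○-homo = λ α → Eq.refl
    }

  -- Given separately because `α [ var ]` does not reduce to `α` for open `α`.
  canonical : Valuation balfi
  canonical = record
    { ⟦_⟧    = lift
    ; ∧-homo = λ α β → Eq.refl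
    ; ∨-homo = λ α β → Eq.refl
    ; ⇒-homo = λ α β → ⇨-classical heytingAlgebra excludedMiddle _ _
    ; ¬-homo = λ α → Eq.refl
    ; ○-homo = λ α → Eq.refl
    }

  balfi-model : 𝔹𝕀 c ℓ Ax balfi
  balfi-model s v {ψ} i = Eq.trans
    (valuation-unique v (substitution σ) (λ n → Eq.refl) ψ)
    (⊢⇒≈⊤ ([] , schema s (instance-[] σ i) ∷ []))
    -- Elements of the algebra are formulas, so `v` restricted to variables already is a
    -- substitution.
    where σ = lower ∘ Valuation.⟦ v ⟧ ∘ var

  completeness : (Γ : Pred Formula g) (φ : Formula) → Γ ⊨[ c , ℓ , Ax ] φ → Γ ⊢[ Ax ] φ
  completeness Γ φ (inj₁ ⊨φ)               = inj₁ (≈⊤⇒⊢ (⊨φ balfi balfi-model canonical))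
  completeness Γ φ (inj₂ (γs , γs⊆Γ , γs⊨φ)) = inj₂ (γs , γs⊆Γ , lower
    -- The hypothesis is an equation `x ≈ x ⊓ y`, as the order of `balfi` is not `≼` itself.
    -- Projecting its right side recovers `≼`.
    (≼-trans (reflexive (foldr₁-homo canonical γs))
      (≼-trans (reflexive (γs⊨φ balfi balfi-model canonical)) (x⊓y≼y _ _))))

theorem3p5 : ∀ {g : Level} (c ℓ : Level) (Ax : Pred Schema 0ℓ) → Satisfiable Ax →
    (Γ : Pred Formula g) (φ : Formula) →
    (Γ ⊢[ Ax ] φ) ⇔ (Γ ⊨[ c , ℓ , Ax ] φ)
theorem3p5 c ℓ Ax _ Γ φ = mk⇔ (soundness Γ φ) (LindenbaumTarski.completeness c ℓ Ax Γ φ)
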